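{- Let $k$ be an integer and let $G$ be a graph with $m(G)\le k$. Then there exists a forest $F\subseteq G$ such that $m_2(G\setminus F)\le k$, where $G\setminus F$ is obtained from $G$ by deleting the edges of $F$ (but no vertices).
   Context: For a graph $J$, $v_J,e_J$ are its numbers of vertices and edges; $m(G)=\max\{e_J/v_J: J\subseteq G, v_J\ge1\}$. For a graph $H$: $m_2(H)=\max\{(e_J-1)/(v_J-2): J\subseteq H, v_J\ge 3\}$ if $H$ has an edge and $v_H\ge3$; $m_2(K_2)=1/2$; $m_2(H)=0$ if $H$ has no edges. -}

module Defs where

open import Data.Nat using (ℕ; zero; suc; _+_; _*_; _∸_; _≤_; _<_; _<ᵇ_)
open import Data.Fin using (Fin; zero; suc; inject₁; fromℕ; toℕ)
open import Data.Bool using (Bool; true; false; if_then_else_; _∧_; not)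
open import Data.Product using (Σ; _×_; ∃-syntax)
open import Relation.Binary.PropositionalEquality using (_≡_)
open import Relation.Nullary using (¬_)
open import Function.Definitions using (Injective)

count : {n : ℕ} → (Fin n → Bool) → ℕ
count {zero}  p = 0
count {suc n} p = (if p zero then 1 else 0) + count {n} (λ i → p (suc i))

sumF : {n : ℕ} → (Fin n → ℕ) → ℕ
sumF {zero}  f = 0
sumF {suc n} f = f zero + sumF {n} (λ i → f (suc i))

countPairs : {n : ℕ} → (Fin n → Fin n → Bool) → ℕ
countPairs {n} r = sumF {n} (λ u → count {n} (λ v → if toℕ u <ᵇ toℕ v then r u v else false))

record Graph (n : ℕ) : Set where
  field
    adj  : Fin n → Fin n → Bool
    sym  : ∀ u v → adj u v ≡ adj v u
    irr  : ∀ u → adj u u ≡ false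
open Graph public

vG : {n : ℕ} → Graph n → ℕ
vG {n} G = n

eG : {n : ℕ} → Graph n → ℕ
eG G = countPairs (adj G)

record Subgraph {n : ℕ} (G : Graph n) : Set where
  field
    verts   : Fin n → Bool
    edges   : Fin n → Fin n → Bool
    esym    : ∀ u v → edges u v ≡ edges v u
    ⊆adj    : ∀ u v → edges u v ≡ true → adj G u v ≡ true
    ⊆vertsˡ : ∀ u v → edges u v ≡ true → verts u ≡ true
open Subgraph public

vJ : {n : ℕ} {G : Graph n} → Subgraph G → ℕ
vJ J = count (verts J)

eJ : {n : ℕ} {G : Graph n} → Subgraph G → ℕ
eJ J = countPairs (edges J)

-- m(G) ≤ k  :⇔  e_J / v_J ≤ k for every subgraph J with v_J ≥ 1.
m≤ : {n : ℕ} → Graph n → ℕ → Set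
m≤ G k = (J : Subgraph G) → 1 ≤ vJ J → eJ J ≤ k * vJ J

-- m₂(H) ≤ k, following the three-case definition of m₂:
--  * if H has no edges, m₂(H) = 0 ≤ k (no condition);
--  * if H has an edge and v_H = 2 (i.e. H = K₂), m₂(H) = 1/2 ≤ k, i.e. 1 ≤ 2k;
--  * if H has an edge and v_H ≥ 3, (e_J - 1)/(v_J - 2) ≤ k for all J ⊆ H with v_J ≥ 3,
--    i.e. e_J ≤ k (v_J - 2) + 1.
m₂≤ : {n : ℕ} → Graph n → ℕ → Set
m₂≤ H k =
  (1 ≤ eG H → vG H ≡ 2 → 1 ≤ 2 * k) ×
  (1 ≤ eG H → 3 ≤ vG H →
     (J : Subgraph H) → 3 ≤ vJ J → eJ J ≤ k * (vJ J ∸ 2) + 1)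

HasCycle : {n : ℕ} → (Fin n → Fin n → Bool) → Set
HasCycle {n} r =
  Σ ℕ λ l → Σ (Fin (suc (suc (suc l))) → Fin n) λ c →
    Injective _≡_ _≡_ c ×
    (∀ (i : Fin (suc (suc l))) → r (c (inject₁ i)) (c (suc i)) ≡ true) ×
    (r (c (fromℕ (suc (suc l)))) (c zero) ≡ true)

-- A spanning forest-subgraph F ⊆ G, given by its edge set (isolated vertices are
-- irrelevant since G ∖ F deletes only the edges of F).
record Forest {n : ℕ} (G : Graph n) : Set where
  field
    fedges  : Fin n → Fin n → Bool
    fsym    : ∀ u v → fedges u v ≡ fedges v u
    f⊆      : ∀ u v → fedges u v ≡ true → adj G u v ≡ true
    acyclic : ¬ HasCycle fedges
open Forest public

_∖_ : {n : ℕ} → (G : Graph n) → Forest G → Graph n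
adj (G ∖ F) u v = adj G u v ∧ not (fedges F u v)
Graph.sym (G ∖ F) u v rewrite Graph.sym G u v | fsym F u v = Relation.Binary.PropositionalEquality.refl
irr (G ∖ F) u rewrite irr G u = Relation.Binary.PropositionalEquality.refl

{-# OPTIONS --safe #-}
module Submission where

-- By Hakimi's theorem G has an orientation of maximum outdegree at most k: otherwise reverse a
-- walk from a vertex of outdegree > k to one of outdegree < k; if there is none, the vertices
-- that cannot reach outdegree < k span more than k times as many edges as vertices.
--
-- Choose one root in every sink strongly connected component of the orientation, and let F
-- consist of one arc from every other vertex, pointing closer to the roots. Removing F leaves
-- outdegree ≤ k at the roots and ≤ k - 1 elsewhere. So a set of a vertices with at most one root,
-- closed under arcs inside J, has e ≤ (k - 1) a + 1 and e ≤ a (a - 1) / 2. The first estimate gives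
-- e ≤ k (a - 2) + 1 when a ≥ 2k, the second when a < 2k, which settles J with at most one root.
-- Likewise e ≤ k (a - 1) for a ≥ 1. If J contains roots s ≠ t, then its vertices reachable from s
-- and those reachable from t are two disjoint closed sets, each saving k edges on the bound k v.

open import Defs
open import Data.Nat using (ℕ; zero; suc; _+_; _*_; _∸_; _≤_; _<_; _<ᵇ_; z≤n; s≤s; s≤s⁻¹)
open import Data.Nat.Properties
open import Data.Nat.Tactic.RingSolver using (solve-∀)
open import Algebra.Properties.CommutativeSemigroup +-commutativeSemigroup using (interchange)
open import Data.Fin using (Fin; zero; suc; toℕ; inject₁; fromℕ)
open import Data.Fin.Properties using (toℕ-injective; any?) renaming (_≟_ to _≟ᶠ_; suc-injective to sucᶠ-injective)
open import Data.Fin.Relation.Unary.Top using (view; ‵fromℕ; ‵inject₁)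
open import Data.Bool using (Bool; true; false; if_then_else_; _∧_; _∨_; not)
open import Data.Bool.Properties using (∨-comm; ∧-comm; ∧-zeroʳ; ¬-not) renaming (_≟_ to _≟ᵇ_)
open import Data.Product using (Σ; _×_; _,_; proj₁; proj₂; ∃-syntax)
open import Data.Sum using (_⊎_; inj₁; inj₂; [_,_]′)
open import Data.Empty using (⊥-elim)
open import Relation.Nullary using (¬_; Dec; yes; no; does; contradiction)
open import Relation.Nullary.Decidable using (_×-dec_; dec-true; dec-false; ¬?)
open import Relation.Binary.Definitions using (tri<; tri≈; tri>)
open import Relation.Binary.PropositionalEquality using (_≡_; _≢_; refl; trans; cong; cong₂; subst; module ≡-Reasoning) renaming (sym to ≡-sym)

private
  variable
    n : ℕ

-- Booleans and indicators

⟦_⟧ : Bool → ℕ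
⟦ b ⟧ = if b then 1 else 0

_==_ : Fin n → Fin n → Bool
x == y = does (x ≟ᶠ y)

∧-true : ∀ {a b} → a ∧ b ≡ true → a ≡ true × b ≡ true
∧-true {true} {true} refl = refl , refl

true∧ : ∀ {a b} → a ≡ true → b ≡ true → a ∧ b ≡ true
true∧ refl refl = refl

∨-true : ∀ {a b} → a ∨ b ≡ true → a ≡ true ⊎ b ≡ true
∨-true {true}  _ = inj₁ refl
∨-true {false} e = inj₂ e

does-sound : {A : Set} (d : Dec A) → does d ≡ true → A
does-sound (yes a) _ = a

==-sound : {x y : Fin n} → x == y ≡ true → x ≡ y
==-sound {x = x} {y} = does-sound (x ≟ᶠ y)

true≢false : ∀ {b : Bool} {A : Set} → b ≡ true → b ≡ false → A
true≢false refl ()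

⟦⟧-mono : ∀ {a b} → (a ≡ true → b ≡ true) → ⟦ a ⟧ ≤ ⟦ b ⟧
⟦⟧-mono {false} h = z≤n
⟦⟧-mono {true}  h rewrite h refl = ≤-refl

-- Finite sums

sumF-cong : {f g : Fin n → ℕ} → (∀ i → f i ≡ g i) → sumF f ≡ sumF g
sumF-cong {zero}  h = refl
sumF-cong {suc n} h = cong₂ _+_ (h zero) (sumF-cong (λ i → h (suc i)))

sumF-mono : {f g : Fin n → ℕ} → (∀ i → f i ≤ g i) → sumF f ≤ sumF g
sumF-mono {zero}  h = z≤n
sumF-mono {suc n} h = +-mono-≤ (h zero) (sumF-mono (λ i → h (suc i)))

sumF-zero : sumF {n} (λ _ → 0) ≡ 0
sumF-zero {zero}  = refl
sumF-zero {suc n} = sumF-zero {n}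

sumF-+ : (f g : Fin n → ℕ) → sumF (λ i → f i + g i) ≡ sumF f + sumF g
sumF-+ {zero}  f g = refl
sumF-+ {suc n} f g =
  trans (cong (f zero + g zero +_) (sumF-+ (λ i → f (suc i)) (λ i → g (suc i))))
        (interchange (f zero) (g zero) _ _)

sumF-*ˡ : (c : ℕ) (f : Fin n → ℕ) → sumF (λ i → c * f i) ≡ c * sumF f
sumF-*ˡ {zero}  c f = ≡-sym (*-zeroʳ c)
sumF-*ˡ {suc n} c f =
  trans (cong (c * f zero +_) (sumF-*ˡ c (λ i → f (suc i))))
        (≡-sym (*-distribˡ-+ c (f zero) _))

sumF-swap : ∀ {m} (f : Fin m → Fin n → ℕ) →
  sumF (λ i → sumF (λ j → f i j)) ≡ sumF (λ j → sumF (λ i → f i j))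
sumF-swap {n} {zero}  f = ≡-sym (sumF-zero {n})
sumF-swap {n} {suc m} f =
  trans (cong (sumF (f zero) +_) (sumF-swap (λ i → f (suc i))))
        (≡-sym (sumF-+ (f zero) _))

count≡sumF : (p : Fin n → Bool) → count p ≡ sumF (λ i → ⟦ p i ⟧)
count≡sumF {zero}  p = refl
count≡sumF {suc n} p = cong (⟦ p zero ⟧ +_) (count≡sumF (λ i → p (suc i)))

sumF-δ : (x : Fin n) → sumF (λ z → ⟦ x == z ⟧) ≡ 1
sumF-δ {suc n} zero    = cong suc (sumF-zero {n})
sumF-δ {suc n} (suc x) = sumF-δ x

δ-refl : (x : Fin n) → ⟦ x == x ⟧ ≡ 1
δ-refl x = cong ⟦_⟧ (dec-true (x ≟ᶠ x) refl)

δ-≢ : {x y : Fin n} → x ≢ y → ⟦ x == y ⟧ ≡ 0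
δ-≢ {x = x} {y} x≢y = cong ⟦_⟧ (dec-false (x ≟ᶠ y) x≢y)

sumF-≤1 : (p : Fin n → Bool) → (∀ x y → p x ≡ true → p y ≡ true → x ≡ y) →
  sumF (λ x → ⟦ p x ⟧) ≤ 1
sumF-≤1 {n} p h with any? (λ x → p x ≟ᵇ true)
... | yes (x , px) =
  ≤-trans (sumF-mono (λ y → ⟦⟧-mono {p y} (λ py → dec-true (x ≟ᶠ y) (h x y px py))))
          (≤-reflexive (sumF-δ x))
... | no none =
  ≤-trans (sumF-mono (λ y → ⟦⟧-mono {p y} {false} (λ py → ⊥-elim (none (y , py)))))
          (≤-trans (≤-reflexive (sumF-zero {n})) z≤n)

-- The indicator of `x` sums to 1 and carries a gain at one vertex into the whole sum. The progress
-- measures, the density count and the arc lost to the forest all rest on this form.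
sumF-sub-δ : (x : Fin n) {f g : Fin n → ℕ} → (∀ z → f z + ⟦ x == z ⟧ ≤ g z) → sumF f < sumF g
sumF-sub-δ x {f} {g} h = begin
  suc (sumF f)                     ≡⟨ +-comm 1 _ ⟩
  sumF f + 1                       ≡⟨ cong (sumF f +_) (sumF-δ x) ⟨
  sumF f + sumF (λ z → ⟦ x == z ⟧) ≡⟨ sumF-+ f _ ⟨
  sumF (λ z → f z + ⟦ x == z ⟧)    ≤⟨ sumF-mono h ⟩
  sumF g                           ∎
  where open ≤-Reasoning

ΣΣ : (Fin n → Fin n → ℕ) → ℕ
ΣΣ f = sumF (λ u → sumF (f u))

ΣΣ-mono : {f g : Fin n → Fin n → ℕ} → (∀ u v → f u v ≤ g u v) → ΣΣ f ≤ ΣΣ g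
ΣΣ-mono h = sumF-mono (λ u → sumF-mono (h u))

ΣΣ-cong : {f g : Fin n → Fin n → ℕ} → (∀ u v → f u v ≡ g u v) → ΣΣ f ≡ ΣΣ g
ΣΣ-cong h = sumF-cong (λ u → sumF-cong (h u))

ΣΣ-+ : (f g : Fin n → Fin n → ℕ) → ΣΣ (λ u v → f u v + g u v) ≡ ΣΣ f + ΣΣ g
ΣΣ-+ f g = trans (sumF-cong (λ u → sumF-+ (f u) (g u))) (sumF-+ (λ u → sumF (f u)) (λ u → sumF (g u)))

-- Counting unordered pairs through ordered ones

_≺_ : Fin n → Fin n → ℕ
u ≺ v = ⟦ toℕ u <ᵇ toℕ v ⟧

<ᵇ-irrefl : ∀ a → (a <ᵇ a) ≡ false
<ᵇ-irrefl zero    = refl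
<ᵇ-irrefl (suc a) = <ᵇ-irrefl a

<ᵇ-connex : ∀ a b → a ≢ b → ⟦ a <ᵇ b ⟧ + ⟦ b <ᵇ a ⟧ ≡ 1
<ᵇ-connex zero    zero    a≢b = contradiction refl a≢b
<ᵇ-connex zero    (suc b) a≢b = refl
<ᵇ-connex (suc a) zero    a≢b = refl
<ᵇ-connex (suc a) (suc b) a≢b = <ᵇ-connex a b (λ e → a≢b (cong suc e))

countPairs≡ΣΣ : (r : Fin n → Fin n → Bool) → countPairs r ≡ ΣΣ (λ u v → (u ≺ v) * ⟦ r u v ⟧)
countPairs≡ΣΣ r = sumF-cong λ u →
  trans (count≡sumF (λ v → if toℕ u <ᵇ toℕ v then r u v else false)) (sumF-cong λ v → if-* (toℕ u <ᵇ toℕ v) (r u v))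
  where
  if-* : ∀ a b → ⟦ if a then b else false ⟧ ≡ ⟦ a ⟧ * ⟦ b ⟧
  if-* false b = refl
  if-* true  b = ≡-sym (+-identityʳ ⟦ b ⟧)

-- Off the diagonal exactly one of `u ≺ v` and `v ≺ u` equals 1; exchanging the two sums renames the
-- terms with `v ≺ u`.
ΣΣ-fold : (q : Fin n → Fin n → ℕ) → (∀ u → q u u ≡ 0) →
  ΣΣ q ≡ ΣΣ (λ u v → (u ≺ v) * (q u v + q v u))
ΣΣ-fold q irrefl = ≡-sym (begin
  ΣΣ (λ u v → (u ≺ v) * (q u v + q v u))
    ≡⟨ ΣΣ-cong (λ u v → *-distribˡ-+ (u ≺ v) (q u v) (q v u)) ⟩
  ΣΣ (λ u v → (u ≺ v) * q u v + (u ≺ v) * q v u)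
    ≡⟨ ΣΣ-+ (λ u v → (u ≺ v) * q u v) (λ u v → (u ≺ v) * q v u) ⟩
  ΣΣ (λ u v → (u ≺ v) * q u v) + ΣΣ (λ u v → (u ≺ v) * q v u)
    ≡⟨ cong (ΣΣ (λ u v → (u ≺ v) * q u v) +_) (sumF-swap (λ u v → (u ≺ v) * q v u)) ⟩
  ΣΣ (λ u v → (u ≺ v) * q u v) + ΣΣ (λ u v → (v ≺ u) * q u v)
    ≡⟨ ΣΣ-+ (λ u v → (u ≺ v) * q u v) (λ u v → (v ≺ u) * q u v) ⟨
  ΣΣ (λ u v → (u ≺ v) * q u v + (v ≺ u) * q u v)
    ≡⟨ ΣΣ-cong pointwise ⟩
  ΣΣ q ∎)
  where
  open ≡-Reasoning
  pointwise : ∀ u v → (u ≺ v) * q u v + (v ≺ u) * q u v ≡ q u v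
  pointwise u v with u ≟ᶠ v
  ... | yes refl rewrite irrefl u = cong₂ _+_ (*-zeroʳ (u ≺ u)) (*-zeroʳ (u ≺ u))
  ... | no u≢v = begin
    (u ≺ v) * q u v + (v ≺ u) * q u v ≡⟨ *-distribʳ-+ (q u v) (u ≺ v) (v ≺ u) ⟨
    ((u ≺ v) + (v ≺ u)) * q u v       ≡⟨ cong (_* q u v) (<ᵇ-connex _ _ (λ e → u≢v (toℕ-injective e))) ⟩
    1 * q u v                         ≡⟨ *-identityˡ _ ⟩
    q u v                             ∎

Asymmetric : (Fin n → Fin n → Bool) → Set
Asymmetric q = ∀ u v → q u v ≡ true → q v u ≡ false

asym⇒irrefl : {q : Fin n → Fin n → Bool} → Asymmetric q → ∀ u → q u u ≡ false
asym⇒irrefl {q = q} asym u with q u u in e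
... | false = refl
... | true  = trans (≡-sym e) (asym u u e)

asym-irrefl₀ : {q : Fin n → Fin n → Bool} → Asymmetric q → ∀ u → ⟦ q u u ⟧ ≡ 0
asym-irrefl₀ asym u = cong ⟦_⟧ (asym⇒irrefl asym u)

countPairs≤ΣΣ : (r q : Fin n → Fin n → Bool) → Asymmetric q →
  (∀ u v → r u v ≡ true → q u v ≡ true ⊎ q v u ≡ true) →
  countPairs r ≤ ΣΣ (λ u v → ⟦ q u v ⟧)
countPairs≤ΣΣ r q asym cover = begin
  countPairs r                                            ≡⟨ countPairs≡ΣΣ r ⟩
  ΣΣ (λ u v → (u ≺ v) * ⟦ r u v ⟧)                        ≤⟨ ΣΣ-mono (λ u v → *-monoʳ-≤ (u ≺ v) (covered u v)) ⟩
  ΣΣ (λ u v → (u ≺ v) * (⟦ q u v ⟧ + ⟦ q v u ⟧))          ≡⟨ ΣΣ-fold _ (asym-irrefl₀ asym) ⟨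
  ΣΣ (λ u v → ⟦ q u v ⟧)                                  ∎
  where
  open ≤-Reasoning
  covered : ∀ u v → ⟦ r u v ⟧ ≤ ⟦ q u v ⟧ + ⟦ q v u ⟧
  covered u v with r u v in e
  ... | false = z≤n
  ... | true with cover u v e
  ...   | inj₁ quv rewrite quv = s≤s z≤n
  ...   | inj₂ qvu rewrite qvu = m≤n+m 1 ⟦ q u v ⟧

-- Asymmetry forbids arcs in both directions, so a pair `u ≺ v` carries at most one arc, which is
-- paid for by its edge.
ΣΣ≤countPairs : (r q : Fin n → Fin n → Bool) → Asymmetric q →
  (∀ u v → r u v ≡ r v u) → (∀ u v → q u v ≡ true → r u v ≡ true) →
  ΣΣ (λ u v → ⟦ q u v ⟧) ≤ countPairs r
ΣΣ≤countPairs r q asym rsym q⊆r = begin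
  ΣΣ (λ u v → ⟦ q u v ⟧)                                  ≡⟨ ΣΣ-fold _ (asym-irrefl₀ asym) ⟩
  ΣΣ (λ u v → (u ≺ v) * (⟦ q u v ⟧ + ⟦ q v u ⟧))          ≤⟨ ΣΣ-mono (λ u v → *-monoʳ-≤ (u ≺ v) (covers u v)) ⟩
  ΣΣ (λ u v → (u ≺ v) * ⟦ r u v ⟧)                        ≡⟨ countPairs≡ΣΣ r ⟨
  countPairs r                                            ∎
  where
  open ≤-Reasoning
  covers : ∀ u v → ⟦ q u v ⟧ + ⟦ q v u ⟧ ≤ ⟦ r u v ⟧
  covers u v with q u v in e
  ... | true rewrite asym u v e | q⊆r u v e = ≤-refl
  ... | false = ⟦⟧-mono (λ qvu → trans (rsym u v) (q⊆r v u qvu))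

-- Reachability

module _ (o : Fin n → Fin n → Bool) where

  -- The vertices from which `T` can be reached along `o`. `closed` makes the set large enough, and
  -- `descend` makes it no larger, since `rank` cannot fall forever. The rank need not be the
  -- distance to `T`.
  record Closure (T : Fin n → Bool) : Set where
    field
      mem     : Fin n → Bool
      rank    : Fin n → ℕ
      base    : ∀ x → T x ≡ true → mem x ≡ true
      closed  : ∀ x y → o x y ≡ true → mem y ≡ true → mem x ≡ true
      descend : ∀ x → mem x ≡ true →
        T x ≡ true ⊎ ∃[ y ] (o x y ≡ true × mem y ≡ true × rank y < rank x)

  abstract
    closure : ∀ T → Closure T
    -- The fuel is the number of vertices outside `T`; each round adds one vertex.
    closure T = grow _ T (λ _ → 0) (λ _ e → e) (λ _ → inj₁) ≤-refl
      where
      grow : ∀ fuel (mem : Fin n → Bool) (rank : Fin n → ℕ) →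
        (∀ x → T x ≡ true → mem x ≡ true) →
        (∀ x → mem x ≡ true →
          T x ≡ true ⊎ ∃[ y ] (o x y ≡ true × mem y ≡ true × rank y < rank x)) →
        sumF (λ z → ⟦ not (mem z) ⟧) ≤ fuel → Closure T
      grow fuel mem rank base descend bound
        with any? (λ x → any? (λ y → (mem x ≟ᵇ false) ×-dec (o x y ≟ᵇ true) ×-dec (mem y ≟ᵇ true)))
      ... | no none = record
        { mem = mem ; rank = rank ; base = base ; descend = descend
        ; closed = λ x y oxy my → ¬-not (λ mx → none (x , y , mx , oxy , my)) }
      ... | yes (x , y , x∉ , oxy , y∈) = continue fuel bound
        where
        mem′ : Fin n → Bool
        mem′ z = (x == z) ∨ mem z
        rank′ : Fin n → ℕ
        rank′ z = if x == z then suc (rank y) else rank z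
        rank′-old : ∀ z → mem z ≡ true → rank′ z ≡ rank z
        rank′-old z z∈ with x ≟ᶠ z
        ... | yes refl = true≢false z∈ x∉
        ... | no  _    = refl
        old⇒new : ∀ z → mem z ≡ true → mem′ z ≡ true
        old⇒new z z∈ with x ≟ᶠ z
        ... | yes _ = refl
        ... | no  _ = z∈
        descend′ : ∀ z → mem′ z ≡ true →
          T z ≡ true ⊎ ∃[ w ] (o z w ≡ true × mem′ w ≡ true × rank′ w < rank′ z)
        descend′ z z∈′ with x ≟ᶠ z
        ... | yes refl =
          -- The new vertex is ranked one above `y`, whose own rank is untouched because `y` was
          -- already a member.
          inj₂ (y , oxy , old⇒new y y∈ , s≤s (≤-reflexive (rank′-old y y∈)))
        ... | no _ with descend z z∈′
        ...   | inj₁ t = inj₁ t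
        ...   | inj₂ (w , ozw , w∈ , lt) =
          inj₂ (w , ozw , old⇒new w w∈ , subst (_< rank z) (≡-sym (rank′-old w w∈)) lt)
        shrink : sumF (λ z → ⟦ not (mem′ z) ⟧) < sumF (λ z → ⟦ not (mem z) ⟧)
        shrink = sumF-sub-δ x pointwise
          where
          pointwise : ∀ z → ⟦ not (mem′ z) ⟧ + ⟦ x == z ⟧ ≤ ⟦ not (mem z) ⟧
          pointwise z with x ≟ᶠ z
          ... | yes refl rewrite x∉ = ≤-refl
          ... | no _ = ≤-reflexive (+-identityʳ _)
        continue : ∀ fuel → sumF (λ z → ⟦ not (mem z) ⟧) ≤ fuel → Closure T
        continue zero       b = contradiction (≤-trans shrink b) λ ()
        continue (suc fuel) b =
          grow fuel mem′ rank′ (λ z t → old⇒new z (base z t)) descend′ (s≤s⁻¹ (≤-trans shrink b))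

  closure-ind : ∀ {T} (C : Closure T) (P : Fin n → Set) →
    (∀ x → T x ≡ true → P x) → (∀ x y → o x y ≡ true → P y → P x) →
    ∀ x → Closure.mem C x ≡ true → P x
  closure-ind C P pT step x x∈ = go _ x x∈ ≤-refl
    where
    open Closure C
    go : ∀ fuel x → mem x ≡ true → rank x ≤ fuel → P x
    go fuel x x∈ b with descend x x∈
    go fuel       x x∈ b | inj₁ t = pT x t
    go zero       x x∈ b | inj₂ (y , oxy , y∈ , lt) = contradiction (≤-trans lt b) λ ()
    go (suc fuel) x x∈ b | inj₂ (y , oxy , y∈ , lt) = step x y oxy (go fuel y y∈ (s≤s⁻¹ (≤-trans lt b)))

  -- A path leads from `x` to `y`: the closure grows backwards from the target.
  reach : Fin n → Fin n → Bool
  reach x y = Closure.mem (closure (y ==_)) x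

  reach-refl : ∀ x → reach x x ≡ true
  reach-refl x = Closure.base (closure (x ==_)) x (dec-true (x ≟ᶠ x) refl)

  reach-step : ∀ {x y} z → o x y ≡ true → reach y z ≡ true → reach x z ≡ true
  reach-step z = Closure.closed (closure (z ==_)) _ _

  reach-ind : ∀ z (P : Fin n → Set) → P z → (∀ x y → o x y ≡ true → P y → P x) →
    ∀ x → reach x z ≡ true → P x
  reach-ind z P pz =
    closure-ind (closure (z ==_)) P (λ x e → subst P (==-sound e) pz)

  reach-trans : ∀ {x y} z → reach x y ≡ true → reach y z ≡ true → reach x z ≡ true
  reach-trans {x} {y} z xy yz =
    reach-ind y (λ w → reach w z ≡ true) yz (λ _ _ → reach-step z) x xy

  -- A transversal of the sink strongly connected components.
  record Roots : Set where
    field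
      root      : Fin n → Bool
      cover     : ∀ x → ∃[ t ] (root t ≡ true × reach x t ≡ true)
      antichain : ∀ s t → root s ≡ true → root t ≡ true → reach s t ≡ true → s ≡ t

  abstract
    -- Starting from all vertices, a candidate that reaches another candidate is discarded; whatever
    -- it covered is covered by the other one through transitivity. When nothing can be discarded,
    -- the candidates form an antichain.
    roots : Roots
    roots = prune _ (λ _ → true) (λ x → x , refl , reach-refl x) ≤-refl
      where
      prune : ∀ fuel (T : Fin n → Bool) → (∀ x → ∃[ t ] (T t ≡ true × reach x t ≡ true)) →
        sumF (λ z → ⟦ T z ⟧) ≤ fuel → Roots
      prune fuel T cover bound
        with any? (λ s → any? (λ t →
               (T s ≟ᵇ true) ×-dec (T t ≟ᵇ true) ×-dec (reach s t ≟ᵇ true) ×-dec ¬? (s ≟ᶠ t)))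
      ... | no none = record { root = T ; cover = cover ; antichain = anti }
        where
        anti : ∀ s t → T s ≡ true → T t ≡ true → reach s t ≡ true → s ≡ t
        anti s t Ts Tt st with s ≟ᶠ t
        ... | yes e = e
        ... | no  ne = ⊥-elim (none (s , t , Ts , Tt , st , ne))
      ... | yes (s , t , Ts , Tt , st , s≢t) = continue fuel bound
        where
        T′ : Fin n → Bool
        T′ z = not (s == z) ∧ T z
        keep : ∀ z → s ≢ z → T z ≡ true → T′ z ≡ true
        keep z s≢z Tz with s ≟ᶠ z
        ... | yes e = contradiction e s≢z
        ... | no  _ = Tz
        cover′ : ∀ x → ∃[ u ] (T′ u ≡ true × reach x u ≡ true)
        cover′ x with cover x
        ... | u , Tu , xu with s ≟ᶠ u
        ...   | yes refl = t , keep t s≢t Tt , reach-trans t xu st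
        ...   | no  s≢u  = u , keep u s≢u Tu , xu
        shrink : sumF (λ z → ⟦ T′ z ⟧) < sumF (λ z → ⟦ T z ⟧)
        shrink = sumF-sub-δ s pointwise
          where
          pointwise : ∀ z → ⟦ T′ z ⟧ + ⟦ s == z ⟧ ≤ ⟦ T z ⟧
          pointwise z with s ≟ᶠ z
          ... | yes refl rewrite Ts = ≤-refl
          ... | no _ = ≤-reflexive (+-identityʳ _)
        continue : ∀ fuel → sumF (λ z → ⟦ T z ⟧) ≤ fuel → Roots
        continue zero       b = contradiction (≤-trans shrink b) λ ()
        continue (suc fuel) b = prune fuel T′ cover′ (s≤s⁻¹ (≤-trans shrink b))

-- Orientations of bounded outdegree

outdeg : (Fin n → Fin n → Bool) → Fin n → ℕ
outdeg o x = sumF (λ y → ⟦ o x y ⟧)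

record Orientation (G : Graph n) : Set where
  field
    arc   : Fin n → Fin n → Bool
    arc⊆  : ∀ u v → arc u v ≡ true → adj G u v ≡ true
    asym  : Asymmetric arc
    total : ∀ u v → adj G u v ≡ true → arc u v ≡ true ⊎ arc v u ≡ true
open Orientation

increasing : (G : Graph n) → Orientation G
increasing G = record
  { arc   = λ u v → (toℕ u <ᵇ toℕ v) ∧ adj G u v
  ; arc⊆  = λ u v e → proj₂ (∧-true {toℕ u <ᵇ toℕ v} e)
  ; asym  = λ u v e → asym′ u v (proj₁ (∧-true {toℕ u <ᵇ toℕ v} e))
  ; total = total′ }
  where
  <ᵇ-asym : ∀ a b → (a <ᵇ b) ≡ true → (b <ᵇ a) ≡ false
  <ᵇ-asym zero    (suc b) e = refl
  <ᵇ-asym (suc a) (suc b) e = <ᵇ-asym a b e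
  asym′ : ∀ u v → (toℕ u <ᵇ toℕ v) ≡ true → (toℕ v <ᵇ toℕ u) ∧ adj G v u ≡ false
  asym′ u v e rewrite <ᵇ-asym (toℕ u) (toℕ v) e = refl
  total′ : ∀ u v → adj G u v ≡ true →
    (toℕ u <ᵇ toℕ v) ∧ adj G u v ≡ true ⊎ (toℕ v <ᵇ toℕ u) ∧ adj G v u ≡ true
  total′ u v e with toℕ u <ᵇ toℕ v in uv | toℕ v <ᵇ toℕ u in vu
  ... | true  | _    = inj₁ e
  ... | false | true = inj₂ (trans (Graph.sym G v u) e)
  ... | false | false with u ≟ᶠ v
  ...   | yes refl = true≢false e (irr G u)
  ...   | no u≢v with <ᵇ-connex (toℕ u) (toℕ v) (λ e → u≢v (toℕ-injective e))
  ...     | c rewrite uv | vu = contradiction c λ ()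

-- Reversing one arc

flipArc : (Fin n → Fin n → Bool) → Fin n → Fin n → Fin n → Fin n → Bool
flipArc o x w u v =
  if (x == u) ∧ (w == v) then false else (if (x == v) ∧ (w == u) then true else o u v)

module _ {G : Graph n} (O : Orientation G) {x w : Fin n} (xw : arc O x w ≡ true) where

  tail≢head : x ≢ w
  tail≢head refl = true≢false xw (asym⇒irrefl (asym O) x)

  flipOrientation : Orientation G
  flipOrientation = record { arc = flipArc (arc O) x w ; arc⊆ = ⊆′ ; asym = asym′ ; total = total′ }
    where
    ⊆′ : ∀ u v → flipArc (arc O) x w u v ≡ true → adj G u v ≡ true
    ⊆′ u v e with x ≟ᶠ u | w ≟ᶠ v | x ≟ᶠ v | w ≟ᶠ u
    ... | yes refl | no _ | yes refl | yes w≡x = contradiction (≡-sym w≡x) tail≢head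
    ... | yes refl | no _ | yes refl | no _ = arc⊆ O u v e
    ... | yes refl | no _ | no _ | _ = arc⊆ O u v e
    ... | no _ | _ | yes refl | yes refl = trans (Graph.sym G w x) (arc⊆ O x w xw)
    ... | no _ | _ | yes refl | no _ = arc⊆ O u v e
    ... | no _ | _ | no _ | _ = arc⊆ O u v e
    asym′ : Asymmetric (flipArc (arc O) x w)
    asym′ u v e with x ≟ᶠ u | w ≟ᶠ v | x ≟ᶠ v | w ≟ᶠ u
    ... | yes refl | yes refl | _ | _ = contradiction e λ ()
    ... | yes refl | no _ | yes refl | yes w≡x = contradiction (≡-sym w≡x) tail≢head
    ... | yes refl | no _ | yes refl | no _ = asym O u v e
    ... | yes refl | no _ | no _ | _ = asym O u v e
    ... | no _ | _ | yes refl | yes refl = refl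
    ... | no _ | yes refl | yes w≡x | no _ = contradiction w≡x tail≢head
    ... | no _ | no _ | yes refl | no _ = asym O u v e
    ... | no _ | yes refl | no _ | _ = asym O u v e
    ... | no _ | no _ | no _ | _ = asym O u v e
    total′ : ∀ u v → adj G u v ≡ true →
      flipArc (arc O) x w u v ≡ true ⊎ flipArc (arc O) x w v u ≡ true
    total′ u v e with x ≟ᶠ u | w ≟ᶠ v | x ≟ᶠ v | w ≟ᶠ u
    ... | yes refl | yes refl | yes w≡x | _ = contradiction w≡x tail≢head
    ... | yes refl | yes refl | no _ | _ = inj₂ refl
    ... | yes refl | no _ | yes refl | _ = true≢false e (irr G u)
    ... | yes refl | no _ | no _ | _ = total O u v e
    ... | no _ | _ | yes refl | yes refl = inj₁ refl
    ... | no _ | yes refl | yes w≡x | no _ = contradiction w≡x tail≢head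
    ... | no _ | no _ | yes refl | no _ = total O u v e
    ... | no _ | yes refl | no _ | _ = total O u v e
    ... | no _ | no _ | no _ | _ = total O u v e

  -- Row `z` changes only in column `w` when `z` is `x`, and in column `x` when `z` is `w`.
  -- Indicators on both sides avoid subtraction and let one identity cover the tail, the head and
  -- all other vertices.
  flip-outdeg : ∀ z → outdeg (arc flipOrientation) z + ⟦ x == z ⟧ ≡ outdeg (arc O) z + ⟦ w == z ⟧
  flip-outdeg z = begin
    outdeg o′ z + ⟦ x == z ⟧
      ≡⟨ cong (outdeg o′ z +_) (spread x w) ⟨
    outdeg o′ z + sumF (λ v → ⟦ x == z ⟧ * ⟦ w == v ⟧)
      ≡⟨ sumF-+ (λ v → ⟦ o′ z v ⟧) (λ v → ⟦ x == z ⟧ * ⟦ w == v ⟧) ⟨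
    sumF (λ v → ⟦ o′ z v ⟧ + ⟦ x == z ⟧ * ⟦ w == v ⟧)
      ≡⟨ sumF-cong pointwise ⟩
    sumF (λ v → ⟦ arc O z v ⟧ + ⟦ w == z ⟧ * ⟦ x == v ⟧)
      ≡⟨ sumF-+ (λ v → ⟦ arc O z v ⟧) (λ v → ⟦ w == z ⟧ * ⟦ x == v ⟧) ⟩
    outdeg (arc O) z + sumF (λ v → ⟦ w == z ⟧ * ⟦ x == v ⟧)
      ≡⟨ cong (outdeg (arc O) z +_) (spread w x) ⟩
    outdeg (arc O) z + ⟦ w == z ⟧ ∎
    where
    open ≡-Reasoning
    o′ = arc flipOrientation
    spread : ∀ a b → sumF (λ v → ⟦ a == z ⟧ * ⟦ b == v ⟧) ≡ ⟦ a == z ⟧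
    spread a b = trans (sumF-*ˡ ⟦ a == z ⟧ (λ v → ⟦ b == v ⟧))
                       (trans (cong (⟦ a == z ⟧ *_) (sumF-δ b)) (*-identityʳ _))
    pointwise : ∀ v → ⟦ o′ z v ⟧ + ⟦ x == z ⟧ * ⟦ w == v ⟧ ≡ ⟦ arc O z v ⟧ + ⟦ w == z ⟧ * ⟦ x == v ⟧
    pointwise v with x ≟ᶠ z | w ≟ᶠ v | x ≟ᶠ v | w ≟ᶠ z
    ... | yes refl | _ | _ | yes w≡x = contradiction (≡-sym w≡x) tail≢head
    ... | yes refl | yes refl | _ | no _ rewrite xw = refl
    ... | yes refl | no _ | yes refl | no _ = refl
    ... | yes refl | no _ | no _ | no _ = refl
    ... | no _ | _ | yes refl | yes refl rewrite asym O x w xw = refl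
    ... | no _ | _ | yes refl | no _ = refl
    ... | no _ | _ | no _ | yes _ = refl
    ... | no _ | _ | no _ | no _ = refl

  flip-outdeg-tail : suc (outdeg (arc flipOrientation) x) ≡ outdeg (arc O) x
  flip-outdeg-tail = begin
    suc (outdeg (arc flipOrientation) x)      ≡⟨ +-comm 1 _ ⟩
    outdeg (arc flipOrientation) x + 1        ≡⟨ cong (outdeg (arc flipOrientation) x +_) (δ-refl x) ⟨
    outdeg (arc flipOrientation) x + ⟦ x == x ⟧ ≡⟨ flip-outdeg x ⟩
    outdeg (arc O) x + ⟦ w == x ⟧             ≡⟨ cong (outdeg (arc O) x +_) (δ-≢ (λ e → tail≢head (≡-sym e))) ⟩
    outdeg (arc O) x + 0                      ≡⟨ +-identityʳ _ ⟩
    outdeg (arc O) x                          ∎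
    where open ≡-Reasoning

  flip-outdeg-head : outdeg (arc flipOrientation) w ≡ suc (outdeg (arc O) w)
  flip-outdeg-head = begin
    outdeg (arc flipOrientation) w            ≡⟨ +-identityʳ _ ⟨
    outdeg (arc flipOrientation) w + 0        ≡⟨ cong (outdeg (arc flipOrientation) w +_) (δ-≢ tail≢head) ⟨
    outdeg (arc flipOrientation) w + ⟦ x == w ⟧ ≡⟨ flip-outdeg w ⟩
    outdeg (arc O) w + ⟦ w == w ⟧             ≡⟨ cong (outdeg (arc O) w +_) (δ-refl w) ⟩
    outdeg (arc O) w + 1                      ≡⟨ +-comm _ 1 ⟩
    suc (outdeg (arc O) w)                    ∎
    where open ≡-Reasoning

  flip-outdeg-other : ∀ {z} → x ≢ z → w ≢ z → outdeg (arc flipOrientation) z ≡ outdeg (arc O) z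
  flip-outdeg-other {z} x≢z w≢z = +-cancelʳ-≡ 0 _ _ (begin
    outdeg (arc flipOrientation) z + 0        ≡⟨ cong (outdeg (arc flipOrientation) z +_) (δ-≢ x≢z) ⟨
    outdeg (arc flipOrientation) z + ⟦ x == z ⟧ ≡⟨ flip-outdeg z ⟩
    outdeg (arc O) z + ⟦ w == z ⟧             ≡⟨ cong (outdeg (arc O) z +_) (δ-≢ w≢z) ⟩
    outdeg (arc O) z + 0                      ∎)
    where open ≡-Reasoning

  flip-keeps : ∀ u v → u ≢ x → arc O u v ≡ true → arc flipOrientation u v ≡ true
  flip-keeps u v u≢x uv with x ≟ᶠ u | w ≟ᶠ v | x ≟ᶠ v | w ≟ᶠ u
  ... | yes x≡u | _ | _ | _ = contradiction (≡-sym x≡u) u≢x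
  ... | no _ | _ | yes _ | yes _ = refl
  ... | no _ | _ | yes _ | no _ = uv
  ... | no _ | _ | no _ | _ = uv

-- Augmenting walks and Hakimi's theorem

data Walk (o : Fin n → Fin n → Bool) : ℕ → Fin n → Fin n → Set where
  -- Allowing `stay` at every `d` makes the index an upper bound on the length; `augment` recurses
  -- on it.
  stay : ∀ {d x} → Walk o d x x
  move : ∀ {d x y z} → o x y ≡ true → Walk o d y z → Walk o (suc d) x z

lengthen : {o : Fin n → Fin n → Bool} {d : ℕ} {x y : Fin n} → Walk o d x y → Walk o (suc d) x y
lengthen stay       = stay
lengthen (move a w) = move a (lengthen w)

-- If the walk meets `x`, its part from there is kept in `o`. Otherwise none of its arcs leaves `x`,
-- so all of them survive in `o′`.
detour : {o o′ : Fin n → Fin n → Bool} (x : Fin n) →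
  (∀ u v → u ≢ x → o u v ≡ true → o′ u v ≡ true) →
  ∀ {d u y} → Walk o d u y → Walk o d x y ⊎ Walk o′ d u y
detour x keeps {u = u} w with u ≟ᶠ x
detour x keeps w | yes refl = inj₁ w
detour x keeps stay | no _ = inj₂ stay
detour x keeps (move a w) | no u≢x with detour x keeps w
... | inj₁ w′ = inj₁ (lengthen w′)
... | inj₂ w′ = inj₂ (move (keeps _ _ u≢x a) w′)

module _ {G : Graph n} (k : ℕ) where

  excess : Orientation G → ℕ
  excess O = sumF (λ z → outdeg (arc O) z ∸ k)

  -- The tail gives up one unit of excess and the head ends with at most `c`. For `c = 0` the total
  -- drops; for `c = 1`, used when the head had outdegree `k`, it does not grow.
  excess-flip : (O : Orientation G) {x w : Fin n} (xw : arc O x w ≡ true) →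
    k < outdeg (arc O) x → ∀ c → suc (outdeg (arc O) w) ∸ k ≤ c →
    excess (flipOrientation O xw) < excess O + c
  excess-flip O {x} {w} xw k<x c w≤c = begin-strict
    excess (flipOrientation O xw)
      <⟨ sumF-sub-δ x pointwise ⟩
    sumF (λ z → (outdeg (arc O) z ∸ k) + c * ⟦ w == z ⟧)
      ≡⟨ sumF-+ (λ z → outdeg (arc O) z ∸ k) (λ z → c * ⟦ w == z ⟧) ⟩
    excess O + sumF (λ z → c * ⟦ w == z ⟧)
      ≡⟨ cong (excess O +_) (sumF-*ˡ c (λ z → ⟦ w == z ⟧)) ⟩
    excess O + c * sumF (λ z → ⟦ w == z ⟧)
      ≡⟨ cong (λ s → excess O + c * s) (sumF-δ w) ⟩
    excess O + c * 1
      ≡⟨ cong (excess O +_) (*-identityʳ c) ⟩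
    excess O + c ∎
    where
    open ≤-Reasoning
    d′ = outdeg (arc (flipOrientation O xw))
    pointwise : ∀ z → (d′ z ∸ k) + ⟦ x == z ⟧ ≤ (outdeg (arc O) z ∸ k) + c * ⟦ w == z ⟧
    pointwise z = by-cases (x ≟ᶠ z) (w ≟ᶠ z)
      where
      by-cases : Dec (x ≡ z) → Dec (w ≡ z) →
        (d′ z ∸ k) + ⟦ x == z ⟧ ≤ (outdeg (arc O) z ∸ k) + c * ⟦ w == z ⟧
      by-cases (yes refl) _ = begin
        (d′ x ∸ k) + ⟦ x == x ⟧ ≡⟨ cong ((d′ x ∸ k) +_) (δ-refl x) ⟩
        (d′ x ∸ k) + 1          ≡⟨ +-comm _ 1 ⟩
        -- Truncation loses nothing: the tail was above `k`, so it still has outdegree at least `k`.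
        1 + (d′ x ∸ k)          ≡⟨ +-∸-assoc 1 (s≤s⁻¹ (subst (k <_) (≡-sym (flip-outdeg-tail O xw)) k<x)) ⟨
        suc (d′ x) ∸ k          ≡⟨ cong (_∸ k) (flip-outdeg-tail O xw) ⟩
        outdeg (arc O) x ∸ k    ≤⟨ m≤m+n _ _ ⟩
        (outdeg (arc O) x ∸ k) + c * ⟦ w == x ⟧ ∎
      by-cases (no x≢w) (yes refl) = begin
        (d′ w ∸ k) + ⟦ x == w ⟧    ≡⟨ cong ((d′ w ∸ k) +_) (δ-≢ x≢w) ⟩
        (d′ w ∸ k) + 0             ≡⟨ +-identityʳ _ ⟩
        d′ w ∸ k                   ≡⟨ cong (_∸ k) (flip-outdeg-head O xw) ⟩
        suc (outdeg (arc O) w) ∸ k ≤⟨ w≤c ⟩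
        c                          ≡⟨ *-identityʳ c ⟨
        c * 1                      ≡⟨ cong (c *_) (δ-refl w) ⟨
        c * ⟦ w == w ⟧             ≤⟨ m≤n+m _ _ ⟩
        (outdeg (arc O) w ∸ k) + c * ⟦ w == w ⟧ ∎
      by-cases (no x≢z) (no w≢z) = begin
        (d′ z ∸ k) + ⟦ x == z ⟧ ≡⟨ cong ((d′ z ∸ k) +_) (δ-≢ x≢z) ⟩
        (d′ z ∸ k) + 0          ≡⟨ +-identityʳ _ ⟩
        d′ z ∸ k                ≡⟨ cong (_∸ k) (flip-outdeg-other O xw x≢z w≢z) ⟩
        outdeg (arc O) z ∸ k    ≤⟨ m≤m+n _ _ ⟩
        (outdeg (arc O) z ∸ k) + c * ⟦ w == z ⟧ ∎

  -- A next vertex above `k` takes over as the start, and one below `k` allows a single reversal to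
  -- finish. One equal to `k` becomes overfull by the reversal, and the process continues from it
  -- along the rest of the walk.
  augment : ∀ d (O : Orientation G) {x y} → Walk (arc O) d x y →
    k < outdeg (arc O) x → outdeg (arc O) y < k → Σ (Orientation G) λ O′ → excess O′ < excess O
  augment d O stay k<x y<k = contradiction k<x (<-asym y<k)
  augment (suc d) O {x} {y} (move {y = w} xw walk) k<x y<k with <-cmp (outdeg (arc O) w) k
  ... | tri> _ _ k<w = augment d O walk k<w y<k
  ... | tri< w<k _ _ =
    flipOrientation O xw ,
    subst (excess (flipOrientation O xw) <_) (+-identityʳ _)
          (excess-flip O xw k<x 0 (≤-reflexive (m≤n⇒m∸n≡0 w<k)))
  -- Reversing the arc can damage the rest of the walk only if that rest passes through `x`; then
  -- the walk is restarted at `x` with a smaller index and nothing is reversed yet.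
  ... | tri≈ _ w≡k _ with detour x (flip-keeps O xw) walk
  ...   | inj₁ walk′ = augment d O walk′ k<x y<k
  ...   | inj₂ walk′ with augment d (flipOrientation O xw) walk′ k<w′ y<k′
    where
    x≢y : x ≢ y
    x≢y refl = <-asym k<x y<k
    w≢y : w ≢ y
    w≢y refl = <⇒≢ y<k w≡k
    k<w′ : k < outdeg (arc (flipOrientation O xw)) w
    k<w′ = ≤-reflexive (≡-sym (trans (flip-outdeg-head O xw) (cong suc w≡k)))
    y<k′ : outdeg (arc (flipOrientation O xw)) y < k
    y<k′ = subst (_< k) (≡-sym (flip-outdeg-other O xw x≢y w≢y)) y<k
  ...     | O′ , lt =
    -- The first reversal does not raise the excess, so the strict drop comes from the recursive
    -- call.
    O′ , ≤-trans lt (s≤s⁻¹ (subst (excess (flipOrientation O xw) <_) (+-comm _ 1)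
                                  (excess-flip O xw k<x 1 1≤)))
    where
    1≤ : suc (outdeg (arc O) w) ∸ k ≤ 1
    1≤ = ≤-reflexive (trans (cong (λ s → suc s ∸ k) w≡k) (m+n∸n≡m 1 k))

  hakimi : m≤ G k → Σ (Orientation G) λ O → ∀ x → outdeg (arc O) x ≤ k
  hakimi sparse = improve _ (increasing G) ≤-refl
    where
    improve : ∀ fuel (O : Orientation G) → excess O ≤ fuel →
      Σ (Orientation G) λ O′ → ∀ x → outdeg (arc O′) x ≤ k
    improve fuel O bound with any? (λ x → k <? outdeg (arc O) x)
    ... | no none = O , λ x → ≮⇒≥ (λ k<x → none (x , k<x))
    ... | yes (x , k<x) = by-cases (mem x) refl
      where
      deficient : Fin n → Bool
      deficient z = does (outdeg (arc O) z <? k)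
      D = closure (arc O) deficient
      open Closure D
      deficient⇒< : ∀ z → deficient z ≡ true → outdeg (arc O) z < k
      deficient⇒< z = does-sound (outdeg (arc O) z <? k)
      walk : ∀ z → mem z ≡ true → ∃[ y ] ∃[ d ] (outdeg (arc O) y < k × Walk (arc O) d z y)
      walk = closure-ind (arc O) D _ (λ z e → z , 0 , deficient⇒< z e , stay)
                         (λ { z w zw (y , d , y<k , wk) → y , suc d , y<k , move zw wk })
      continue : ∀ fuel → excess O ≤ fuel → Σ (Orientation G) (λ O′ → excess O′ < excess O) →
        Σ (Orientation G) λ O′ → ∀ x → outdeg (arc O′) x ≤ k
      continue zero       b (O′ , lt) = contradiction (≤-trans lt b) λ ()
      continue (suc fuel) b (O′ , lt) = improve fuel O′ (s≤s⁻¹ (≤-trans lt b))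

      -- The vertices with no walk to a deficient vertex. No arc leaves this set, so every arc with
      -- its tail inside is an edge of the induced subgraph.
      S : Fin n → Bool
      S z = not (mem z)
      S-closed : ∀ u v → S u ≡ true → arc O u v ≡ true → S v ≡ true
      S-closed u v Su uv with mem v in e
      ... | false = refl
      ... | true rewrite closed u v uv e = Su
      induced : Subgraph G
      induced = record
        { verts = S
        ; edges = λ u v → (S u ∧ S v) ∧ adj G u v
        ; esym = λ u v → cong₂ _∧_ (∧-comm (S u) (S v)) (Graph.sym G u v)
        ; ⊆adj = λ u v e → proj₂ (∧-true {S u ∧ S v} e)
        ; ⊆vertsˡ = λ u v e → proj₁ (∧-true {S u} (proj₁ (∧-true {S u ∧ S v} e))) }
      dense : S x ≡ true → k * vJ induced < eJ induced
      dense Sx = begin-strict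
        k * count S                         ≡⟨ cong (k *_) (count≡sumF S) ⟩
        k * sumF (λ z → ⟦ S z ⟧)            ≡⟨ sumF-*ˡ k (λ z → ⟦ S z ⟧) ⟨
        -- Members have outdegree at least `k`, as deficient vertices lie in the base of the
        -- closure; strictness comes from `x`.
        sumF (λ z → k * ⟦ S z ⟧)            <⟨ sumF-sub-δ x pointwise ⟩
        ΣΣ (λ u v → ⟦ S u ∧ arc O u v ⟧)    ≤⟨ ΣΣ≤countPairs _ _ S-asym (esym induced) S⊆ ⟩
        eJ induced                          ∎
        where
        open ≤-Reasoning
        S-asym : Asymmetric (λ u v → S u ∧ arc O u v)
        S-asym u v e rewrite asym O u v (proj₂ (∧-true {S u} e)) = ∧-zeroʳ (S v)
        S⊆ : ∀ u v → S u ∧ arc O u v ≡ true → edges induced u v ≡ true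
        S⊆ u v e with ∧-true {S u} e
        ... | Su , uv = true∧ (true∧ Su (S-closed u v Su uv)) (arc⊆ O u v uv)
        k≤ : ∀ z → S z ≡ true → k ≤ outdeg (arc O) z
        k≤ z Sz = ≮⇒≥ λ lt →
          true≢false Sz (cong not (base z (dec-true (outdeg (arc O) z <? k) lt)))
        pointwise : ∀ z → k * ⟦ S z ⟧ + ⟦ x == z ⟧ ≤ sumF (λ v → ⟦ S z ∧ arc O z v ⟧)
        pointwise z = split (x ≟ᶠ z) (S z) refl
          where
          split : Dec (x ≡ z) → ∀ b → S z ≡ b → k * ⟦ b ⟧ + ⟦ x == z ⟧ ≤ sumF (λ v → ⟦ b ∧ arc O z v ⟧)
          split (yes refl) false Sx′ = true≢false Sx Sx′
          split (yes refl) true _ = begin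
            k * 1 + ⟦ x == x ⟧ ≡⟨ cong₂ _+_ (*-identityʳ k) (δ-refl x) ⟩
            k + 1              ≡⟨ +-comm k 1 ⟩
            suc k              ≤⟨ k<x ⟩
            outdeg (arc O) x   ∎
          split (no x≢z) false _ = begin
            k * 0 + ⟦ x == z ⟧ ≡⟨ cong₂ _+_ (*-zeroʳ k) (δ-≢ x≢z) ⟩
            0                  ≤⟨ z≤n ⟩
            sumF {n} (λ _ → 0) ∎
          split (no x≢z) true Sz = begin
            k * 1 + ⟦ x == z ⟧ ≡⟨ cong₂ _+_ (*-identityʳ k) (δ-≢ x≢z) ⟩
            k + 0              ≡⟨ +-identityʳ k ⟩
            k                  ≤⟨ k≤ z Sz ⟩
            outdeg (arc O) z   ∎
      inhabited : S x ≡ true → 1 ≤ vJ induced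
      inhabited Sx = begin
        1                        ≡⟨ sumF-δ x ⟨
        sumF (λ z → ⟦ x == z ⟧)  ≤⟨ sumF-mono (λ z → ⟦⟧-mono {x == z} {S z} (λ e → subst (λ y → S y ≡ true) (==-sound e) Sx)) ⟩
        sumF (λ z → ⟦ S z ⟧)     ≡⟨ count≡sumF S ⟨
        count S                  ∎
        where open ≤-Reasoning

      by-cases : ∀ b → mem x ≡ b → Σ (Orientation G) λ O′ → ∀ x → outdeg (arc O′) x ≤ k
      by-cases true x∈ with walk x x∈
      ... | y , d , y<k , wk = continue fuel bound (augment d O wk k<x y<k)
      by-cases false x∉ =
        contradiction (sparse induced (inhabited Sx)) (<⇒≱ (dense Sx))
        where
        Sx : S x ≡ true
        Sx = cong not x∉

-- Forests from parent relations

argmax : ∀ {m} (g : Fin (suc m) → ℕ) → ∃[ i ] (∀ j → g j ≤ g i)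
argmax {zero} g = zero , λ { zero → ≤-refl }
argmax {suc m} g with argmax (λ j → g (suc j))
... | i , max with ≤-total (g zero) (g (suc i))
...   | inj₁ le = suc i , λ { zero → le ; (suc j) → max j }
...   | inj₂ ge = zero , λ { zero → ≤-refl ; (suc j) → ≤-trans (max j) ge }

module _ (par : Fin n → Fin n → Bool) (rank : Fin n → ℕ)
         (par-rank : ∀ x y → par x y ≡ true → rank y < rank x)
         (par-unique : ∀ x y z → par x y ≡ true → par x z ≡ true → y ≡ z) where

  joined : Fin n → Fin n → Bool
  joined u v = par u v ∨ par v u

  joined-sym : ∀ u v → joined u v ≡ joined v u
  joined-sym u v = ∨-comm (par u v) (par v u)

  -- Both neighbours of a vertex of maximal rank on a cycle would be its parent.
  joined-acyclic : ¬ HasCycle joined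
  joined-acyclic (l , c , inj , step , wrap) with argmax (λ i → rank (c i))
  ... | i , max with neighbours i
    where
    back : ∀ {u v} → joined u v ≡ true → joined v u ≡ true
    back {u} {v} e = trans (joined-sym v u) e
    inject₁²≢ : ∀ {m} (j : Fin m) → inject₁ (inject₁ j) ≢ suc (suc j)
    inject₁²≢ (suc j) e = inject₁²≢ j (sucᶠ-injective e)
    neighbours : ∀ i → ∃[ j ] ∃[ j′ ] (j ≢ j′ × joined (c i) (c j) ≡ true × joined (c i) (c j′) ≡ true)
    -- The closing edge supplies the second neighbour of the first and of the last vertex; an
    -- interior vertex has neighbours two places apart.
    neighbours zero = suc zero , fromℕ _ , (λ ()) , step zero , back wrap
    neighbours (suc i) with view i
    ... | ‵fromℕ = inject₁ i , zero , (λ ()) , back (step i) , wrap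
    ... | ‵inject₁ j = inject₁ i , suc (suc j) , inject₁²≢ j , back (step i) , step (suc j)
  ...   | j , j′ , j≢j′ , e , e′ = j≢j′ (inj (par-unique (c i) (c j) (c j′) (up j e) (up j′ e′)))
    where
    up : ∀ j → joined (c i) (c j) ≡ true → par (c i) (c j) ≡ true
    up j e with ∨-true {par (c i) (c j)} e
    ... | inj₁ p = p
    -- Here `c j` would be a child of `c i` and would exceed the maximal rank.
    ... | inj₂ p = contradiction (max j) (<⇒≱ (par-rank (c j) (c i) p))

-- Counting arcs

size : (Fin n → Bool) → ℕ
size A = sumF (λ u → ⟦ A u ⟧)

module _ (p : Fin n → Fin n → Bool) where

  -- Arcs are counted by their tails, so counts over disjoint sets add up. For a set closed under
  -- `p` this is the number of arcs inside it.
  arcs : (Fin n → Bool) → ℕ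
  arcs A = sumF (λ u → ⟦ A u ⟧ * outdeg p u)

  arcs≡ΣΣ : ∀ A → arcs A ≡ ΣΣ (λ u v → ⟦ A u ⟧ * ⟦ p u v ⟧)
  arcs≡ΣΣ A = sumF-cong (λ u → ≡-sym (sumF-*ˡ ⟦ A u ⟧ (λ v → ⟦ p u v ⟧)))

  arcs≤k*size : ∀ k → (∀ x → outdeg p x ≤ k) → ∀ A → arcs A ≤ k * size A
  arcs≤k*size k deg A =
    ≤-trans (sumF-mono λ u → ≤-trans (*-monoʳ-≤ ⟦ A u ⟧ (deg u)) (≤-reflexive (*-comm ⟦ A u ⟧ k)))
            (≤-reflexive (sumF-*ˡ k (λ u → ⟦ A u ⟧)))

  -- Vertices outside `T` have outdegree at most `k - 1`, and `T` marks the exceptions that may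
  -- attain `k`. Adding `size A` on the left avoids a truncated `k - 1`.
  arcs+size≤ : ∀ k (T : Fin n → Bool) → (∀ x → suc (outdeg p x) ≤ k + ⟦ T x ⟧) → ∀ A →
    arcs A + size A ≤ k * size A + size (λ u → A u ∧ T u)
  arcs+size≤ k T deg A = begin
    arcs A + size A ≡⟨ sumF-+ (λ u → ⟦ A u ⟧ * outdeg p u) (λ u → ⟦ A u ⟧) ⟨
    sumF (λ u → ⟦ A u ⟧ * outdeg p u + ⟦ A u ⟧) ≤⟨ sumF-mono pointwise ⟩
    sumF (λ u → k * ⟦ A u ⟧ + ⟦ A u ∧ T u ⟧) ≡⟨ sumF-+ (λ u → k * ⟦ A u ⟧) (λ u → ⟦ A u ∧ T u ⟧) ⟩
    sumF (λ u → k * ⟦ A u ⟧) + size (λ u → A u ∧ T u) ≡⟨ cong (_+ size (λ u → A u ∧ T u)) (sumF-*ˡ k (λ u → ⟦ A u ⟧)) ⟩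
    k * size A + size (λ u → A u ∧ T u) ∎
    where
    open ≤-Reasoning
    pointwise : ∀ u → ⟦ A u ⟧ * outdeg p u + ⟦ A u ⟧ ≤ k * ⟦ A u ⟧ + ⟦ A u ∧ T u ⟧
    pointwise u with A u
    ... | false = z≤n
    ... | true = begin
      1 * outdeg p u + 1  ≡⟨ cong (_+ 1) (*-identityˡ _) ⟩
      outdeg p u + 1      ≡⟨ +-comm _ 1 ⟩
      suc (outdeg p u)    ≤⟨ deg u ⟩
      k + ⟦ T u ⟧         ≡⟨ cong (_+ ⟦ T u ⟧) (*-identityʳ k) ⟨
      k * 1 + ⟦ T u ⟧     ∎

  -- Among the ordered pairs of members, the arcs, the reversed arcs and the diagonal are disjoint
  -- families; closure under `p` keeps heads inside `A`. This is e ≤ a (a - 1) / 2 without division.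
  arcs≤pairs : Asymmetric p → ∀ A → (∀ u v → A u ≡ true → p u v ≡ true → A v ≡ true) →
    arcs A + arcs A + size A ≤ size A * size A
  arcs≤pairs p-asym A A-closed = begin
    arcs A + arcs A + size A
      ≡⟨ cong₂ _+_ (cong₂ _+_ (arcs≡ΣΣ A) (trans (arcs≡ΣΣ A) (sumF-swap out))) diagonal ⟩
    ΣΣ out + ΣΣ (λ u v → out v u) + ΣΣ diag
      ≡⟨ cong (_+ ΣΣ diag) (ΣΣ-+ out (λ u v → out v u)) ⟨
    ΣΣ (λ u v → out u v + out v u) + ΣΣ diag
      ≡⟨ ΣΣ-+ (λ u v → out u v + out v u) diag ⟨
    ΣΣ (λ u v → out u v + out v u + diag u v)
      ≤⟨ ΣΣ-mono pointwise ⟩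
    ΣΣ (λ u v → ⟦ A u ⟧ * ⟦ A v ⟧)
      ≡⟨ sumF-cong (λ u → trans (sumF-*ˡ ⟦ A u ⟧ (λ v → ⟦ A v ⟧)) (*-comm ⟦ A u ⟧ (size A))) ⟩
    sumF (λ u → size A * ⟦ A u ⟧)
      ≡⟨ sumF-*ˡ (size A) (λ u → ⟦ A u ⟧) ⟩
    size A * size A ∎
    where
    open ≤-Reasoning
    out diag : Fin n → Fin n → ℕ
    out u v = ⟦ A u ⟧ * ⟦ p u v ⟧
    diag u v = ⟦ A u ⟧ * ⟦ u == v ⟧
    diagonal : size A ≡ ΣΣ diag
    diagonal = sumF-cong λ u → ≡-sym (trans (sumF-*ˡ ⟦ A u ⟧ (λ v → ⟦ u == v ⟧))
                                       (trans (cong (⟦ A u ⟧ *_) (sumF-δ u)) (*-identityʳ _)))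
    out≤ : ∀ u v → out u v ≤ ⟦ A u ⟧ * ⟦ A v ⟧
    out≤ u v with A u in Au | p u v in uv
    ... | false | _ = z≤n
    ... | true | false = z≤n
    ... | true | true rewrite A-closed u v Au uv = ≤-refl
    out-zero : ∀ u v → p u v ≡ false → out u v ≡ 0
    out-zero u v e rewrite e = *-zeroʳ ⟦ A u ⟧
    pointwise : ∀ u v → out u v + out v u + diag u v ≤ ⟦ A u ⟧ * ⟦ A v ⟧
    pointwise u v with u ≟ᶠ v
    ... | yes refl rewrite out-zero u u (asym⇒irrefl p-asym u) with A u
    ...   | false = z≤n
    ...   | true  = ≤-refl
    pointwise u v | no _ rewrite *-zeroʳ ⟦ A u ⟧ | +-identityʳ (out u v + out v u)
      with p u v in uv
    ... | true rewrite out-zero v u (p-asym u v uv) | +-identityʳ (⟦ A u ⟧ * 1) =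
      subst (λ b → ⟦ A u ⟧ * ⟦ b ⟧ ≤ ⟦ A u ⟧ * ⟦ A v ⟧) uv (out≤ u v)
    ... | false rewrite *-zeroʳ ⟦ A u ⟧ =
      ≤-trans (out≤ v u) (≤-reflexive (*-comm ⟦ A v ⟧ ⟦ A u ⟧))

-- Numerical estimates

half-≤ : ∀ {e f} → e + e ≤ f + f → e ≤ f
half-≤ {e} {f} h = ≮⇒≥ λ f<e → <⇒≱ (+-mono-< f<e f<e) h

-- With a = b + 1 the claim is e ≤ k b. For k ≤ b the linear estimate suffices; for b < k the
-- quadratic one gives 2e ≤ b (b + 1) ≤ b k.
closed-bound : ∀ {k e a} → 1 ≤ a → e + a ≤ k * a + 1 → e + e + a ≤ a * a → e + k ≤ k * a
closed-bound {k} {e} {suc b} _ linear quadratic with k ≤? b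
... | yes k≤b = +-cancelʳ-≤ 1 _ _ (begin
  e + k + 1       ≡⟨ trans (+-assoc e k 1) (cong (e +_) (+-comm k 1)) ⟩
  e + suc k       ≤⟨ +-monoʳ-≤ e (s≤s k≤b) ⟩
  e + suc b       ≤⟨ linear ⟩
  k * suc b + 1   ∎)
  where open ≤-Reasoning
... | no k≰b = begin
  e + k      ≤⟨ +-monoˡ-≤ k e≤ ⟩
  k * b + k  ≡⟨ trans (+-comm (k * b) k) (≡-sym (*-suc k b)) ⟩
  k * suc b  ∎
  where
  open ≤-Reasoning
  e≤ : e ≤ k * b
  e≤ = begin
    e         ≤⟨ m≤m+n e e ⟩
    e + e     ≤⟨ +-cancelʳ-≤ (suc b) _ _ (≤-trans quadratic (≤-reflexive (+-comm (suc b) (b * suc b)))) ⟩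
    b * suc b ≤⟨ *-monoʳ-≤ b (≰⇒> k≰b) ⟩
    b * k     ≡⟨ *-comm b k ⟩
    k * b     ∎

-- The linear estimate exceeds the target by 2k - a, so it suffices for a ≥ 2k. Below that, with a =
-- b + 2, the quadratic one gives 2e ≤ b (b + 3) + 2, where b + 3 ≤ 2k.
sparse-bound : ∀ {k e a} → 2 ≤ a → e + a ≤ k * a + 1 → e + e + a ≤ a * a → e ≤ k * (a ∸ 2) + 1
sparse-bound {k} {e} {suc (suc b)} (s≤s (s≤s z≤n)) linear quadratic with k + k ≤? suc (suc b)
... | yes 2k≤a = +-cancelʳ-≤ (2 + b) _ _ (begin
  e + (2 + b)             ≤⟨ linear ⟩
  k * (2 + b) + 1         ≡⟨ expand k b ⟩
  (k * b + 1) + (k + k)   ≤⟨ +-monoʳ-≤ (k * b + 1) 2k≤a ⟩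
  (k * b + 1) + (2 + b)   ∎)
  where
  open ≤-Reasoning
  expand : ∀ k b → k * (2 + b) + 1 ≡ (k * b + 1) + (k + k)
  expand = solve-∀
... | no 2k≰a = half-≤ (+-cancelʳ-≤ (2 + b) _ _ (begin
  e + e + (2 + b)                       ≤⟨ quadratic ⟩
  (2 + b) * (2 + b)                     ≡⟨ square b ⟩
  b * (3 + b) + 2 + (2 + b)             ≤⟨ +-monoˡ-≤ (2 + b) (+-monoˡ-≤ 2 (*-monoʳ-≤ b (≰⇒> 2k≰a))) ⟩
  b * (k + k) + 2 + (2 + b)             ≡⟨ expand k b ⟩
  (k * b + 1) + (k * b + 1) + (2 + b)   ∎))
  where
  open ≤-Reasoning
  square : ∀ b → (2 + b) * (2 + b) ≡ b * (3 + b) + 2 + (2 + b)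
  square = solve-∀
  expand : ∀ k b → b * (k + k) + 2 + (2 + b) ≡ (k * b + 1) + (k * b + 1) + (2 + b)
  expand = solve-∀

-- The savings of `k` in each of the first two classes pay for the 2 subtracted in the target.
two-classes-bound : ∀ {k e₁ e₂ e₃ a₁ a₂ a₃} → 2 ≤ a₁ + a₂ + a₃ →
  e₁ + k ≤ k * a₁ → e₂ + k ≤ k * a₂ → e₃ ≤ k * a₃ →
  e₁ + e₂ + e₃ ≤ k * (a₁ + a₂ + a₃ ∸ 2) + 1
two-classes-bound {k} {e₁} {e₂} {e₃} {a₁} {a₂} {a₃} 2≤a h₁ h₂ h₃ =
  ≤-trans (+-cancelʳ-≤ (k * 2) _ _ (begin
    e₁ + e₂ + e₃ + k * 2                ≡⟨ regroup e₁ e₂ e₃ k ⟩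
    (e₁ + k) + (e₂ + k) + e₃            ≤⟨ +-mono-≤ (+-mono-≤ h₁ h₂) h₃ ⟩
    k * a₁ + k * a₂ + k * a₃            ≡⟨ factor k a₁ a₂ a₃ ⟩
    k * (a₁ + a₂ + a₃)                  ≡⟨ cong (k *_) (m∸n+n≡m 2≤a) ⟨
    k * (a₁ + a₂ + a₃ ∸ 2 + 2)          ≡⟨ *-distribˡ-+ k (a₁ + a₂ + a₃ ∸ 2) 2 ⟩
    k * (a₁ + a₂ + a₃ ∸ 2) + k * 2      ∎)) (m≤m+n _ 1)
  where
  open ≤-Reasoning
  regroup : ∀ e₁ e₂ e₃ k → e₁ + e₂ + e₃ + k * 2 ≡ (e₁ + k) + (e₂ + k) + e₃
  regroup = solve-∀
  factor : ∀ k a₁ a₂ a₃ → k * a₁ + k * a₂ + k * a₃ ≡ k * (a₁ + a₂ + a₃)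
  factor = solve-∀

-- The forest

module _ {G : Graph n} (k : ℕ) (O : Orientation G) (outdeg≤k : ∀ x → outdeg (arc O) x ≤ k) where

  private
    o : Fin n → Fin n → Bool
    o = arc O

  open Roots (roots o)
  open Closure (closure o root) using (mem; rank; base; closed; descend)

  -- Makes `descend` applicable at every vertex: each reaches a root by `cover`, and membership
  -- travels back along the arcs.
  mem-all : ∀ x → mem x ≡ true
  mem-all x with cover x
  ... | t , Tt , xt = reach-ind o t (λ y → mem y ≡ true) (base t Tt) closed x xt

  -- Some root `u` is reachable from `x`, hence from `s` and `t`, and the antichain property
  -- identifies all three. Distinct roots therefore reach disjoint sets.
  reaches-unique-root : ∀ {s t x} → root s ≡ true → root t ≡ true →
    reach o s x ≡ true → reach o t x ≡ true → s ≡ t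
  reaches-unique-root {s} {t} {x} Ts Tt sx tx with cover x
  ... | u , Tu , xu =
    trans (antichain s u Ts Tu (reach-trans o u sx xu))
          (≡-sym (antichain t u Tt Tu (reach-trans o u tx xu)))

  -- Where `descend` certifies a root there is no parent; elsewhere it is the head of the single arc
  -- supplied, along which the rank drops.
  parent : Fin n → Fin n → Bool
  parent x y = [ (λ _ → false) , (λ d → proj₁ d == y) ]′ (descend x (mem-all x))

  parent-arc : ∀ x y → parent x y ≡ true → o x y ≡ true × rank y < rank x
  parent-arc x y e with descend x (mem-all x)
  ... | inj₂ (z , xz , _ , lt) with ==-sound {x = z} {y} e
  ...   | refl = xz , lt

  parent-unique : ∀ x y z → parent x y ≡ true → parent x z ≡ true → y ≡ z
  parent-unique x y z e e′ with descend x (mem-all x)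
  ... | inj₂ (w , _) = trans (≡-sym (==-sound {x = w} {y} e)) (==-sound {x = w} {z} e′)

  parent-exists : ∀ x → root x ≡ false → ∃[ y ] parent x y ≡ true
  parent-exists x x∉ with descend x (mem-all x)
  ... | inj₁ x∈ = true≢false x∈ x∉
  ... | inj₂ (y , _) = y , dec-true (y ≟ᶠ y) refl

  parentForest : Forest G
  parentForest = record
    { fedges  = λ u v → parent u v ∨ parent v u
    ; fsym    = joined-sym parent rank (λ x y e → proj₂ (parent-arc x y e)) parent-unique
    ; f⊆      = λ u v e → [ (λ p → arc⊆ O u v (proj₁ (parent-arc u v p)))
                          , (λ p → trans (Graph.sym G u v) (arc⊆ O v u (proj₁ (parent-arc v u p)))) ]′
                          (∨-true {parent u v} e)
    ; acyclic = joined-acyclic parent rank (λ x y e → proj₂ (parent-arc x y e)) parent-unique }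

  eG≤ : eG (G ∖ parentForest) ≤ n * k
  eG≤ = begin
    eG (G ∖ parentForest)       ≤⟨ countPairs≤ΣΣ _ o (asym O) (λ u v e → total O u v (proj₁ (∧-true {adj G u v} e))) ⟩
    sumF (outdeg o)             ≤⟨ sumF-mono outdeg≤k ⟩
    sumF {n} (λ _ → k)          ≡⟨ sumF-const n ⟩
    n * k                       ∎
    where
    open ≤-Reasoning
    sumF-const : ∀ m → sumF {m} (λ _ → k) ≡ m * k
    sumF-const zero    = refl
    sumF-const (suc m) = cong (k +_) (sumF-const m)

  -- Edge counts in subgraphs that avoid the forest

  module _ (J : Subgraph (G ∖ parentForest)) where

    private
      p : Fin n → Fin n → Bool
      p u v = edges J u v ∧ o u v

      p⇒edge : ∀ {u v} → p u v ≡ true → edges J u v ≡ true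
      p⇒edge {u} {v} e = proj₁ (∧-true {edges J u v} e)

      p⇒arc : ∀ {u v} → p u v ≡ true → o u v ≡ true
      p⇒arc {u} {v} e = proj₂ (∧-true {edges J u v} e)

      p-asym : Asymmetric p
      p-asym u v e rewrite asym O u v (p⇒arc e) = ∧-zeroʳ (edges J v u)

      p-head : ∀ u v → p u v ≡ true → verts J v ≡ true
      p-head u v e = ⊆vertsˡ J v u (trans (esym J v u) (p⇒edge e))

      p≤o : ∀ u v → ⟦ p u v ⟧ ≤ ⟦ o u v ⟧
      p≤o u v = ⟦⟧-mono {p u v} {o u v} p⇒arc

      p-deg : ∀ x → outdeg p x ≤ k
      p-deg x = ≤-trans (sumF-mono (p≤o x)) (outdeg≤k x)

      p-avoids-parent : ∀ u v → parent u v ≡ true → p u v ≡ false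
      p-avoids-parent u v par = ¬-not λ e →
        true≢false (proj₂ (∧-true {adj G u v} (⊆adj J u v (p⇒edge e))))
                   (cong (λ b → not (b ∨ parent v u)) par)

      -- The arc from a non-root to its parent lies in the forest, so one of its at most `k` arcs is
      -- missing from `J`.
      p-deg-nonroot : ∀ x → root x ≡ false → outdeg p x < k
      p-deg-nonroot x x∉ with parent-exists x x∉
      ... | y , xy = ≤-trans (sumF-sub-δ y pointwise) (outdeg≤k x)
        where
        pointwise : ∀ z → ⟦ p x z ⟧ + ⟦ y == z ⟧ ≤ ⟦ o x z ⟧
        pointwise z with y ≟ᶠ z
        ... | no _ = ≤-trans (≤-reflexive (+-identityʳ _)) (p≤o x z)
        ... | yes refl rewrite p-avoids-parent x y xy | proj₁ (parent-arc x y xy) = ≤-refl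

      p-deg-root : ∀ x → suc (outdeg p x) ≤ k + ⟦ root x ⟧
      p-deg-root x with root x in e
      ... | true  = ≤-trans (s≤s (p-deg x)) (≤-reflexive (+-comm 1 k))
      ... | false = ≤-trans (p-deg-nonroot x e) (≤-reflexive (≡-sym (+-identityʳ k)))

      eJ≤arcs : eJ J ≤ arcs p (verts J)
      eJ≤arcs = begin
        eJ J                                     ≤⟨ countPairs≤ΣΣ _ p p-asym oriented ⟩
        ΣΣ (λ u v → ⟦ p u v ⟧)                   ≤⟨ ΣΣ-mono inside ⟩
        ΣΣ (λ u v → ⟦ verts J u ⟧ * ⟦ p u v ⟧)   ≡⟨ arcs≡ΣΣ p (verts J) ⟨
        arcs p (verts J)                         ∎
        where
        open ≤-Reasoning
        oriented : ∀ u v → edges J u v ≡ true → p u v ≡ true ⊎ p v u ≡ true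
        oriented u v e with total O u v (proj₁ (∧-true {adj G u v} (⊆adj J u v e)))
        ... | inj₁ uv = inj₁ (true∧ e uv)
        ... | inj₂ vu = inj₂ (true∧ (trans (esym J v u) e) vu)
        inside : ∀ u v → ⟦ p u v ⟧ ≤ ⟦ verts J u ⟧ * ⟦ p u v ⟧
        inside u v with p u v in e
        ... | false = z≤n
        ... | true rewrite ⊆vertsˡ J u v (p⇒edge e) = ≤-refl

      linear : ∀ A → (∀ s t → A s ∧ root s ≡ true → A t ∧ root t ≡ true → s ≡ t) →
        arcs p A + size A ≤ k * size A + 1
      linear A one-root =
        ≤-trans (arcs+size≤ p k root p-deg-root A)
                (+-monoʳ-≤ (k * size A) (sumF-≤1 (λ u → A u ∧ root u) one-root))

      -- Paths may leave `J`: reachability in the whole orientation makes the antichain property of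
      -- the roots available.
      below : Fin n → Fin n → Bool
      below t x = verts J x ∧ reach o t x

      -- No root other than `t` is reachable from `t`, and the set is closed under arcs of `J`, so
      -- both the linear and the quadratic estimate apply.
      below-bound : ∀ t → verts J t ≡ true → root t ≡ true →
        arcs p (below t) + k ≤ k * size (below t)
      below-bound t t∈ Tt = closed-bound {k} inhabited (linear (below t) one-root)
                                         (arcs≤pairs p p-asym (below t) closed-under)
        where
        inhabited : 1 ≤ size (below t)
        inhabited = ≤-trans (≤-reflexive (≡-sym (sumF-δ t)))
          (sumF-mono λ x → ⟦⟧-mono {t == x} {below t x} λ e →
            subst (λ y → below t y ≡ true) (==-sound e) (true∧ t∈ (reach-refl o t)))
        one-root : ∀ s u → below t s ∧ root s ≡ true → below t u ∧ root u ≡ true → s ≡ u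
        one-root s u es eu = trans (≡-sym (only s es)) (only u eu)
          where
          only : ∀ s → below t s ∧ root s ≡ true → t ≡ s
          only s e with ∧-true {below t s} e
          ... | b , Ts = antichain t s Tt Ts (proj₂ (∧-true {verts J s} b))
        closed-under : ∀ u v → below t u ≡ true → p u v ≡ true → below t v ≡ true
        closed-under u v e uv =
          true∧ (p-head u v uv)
                (reach-trans o v (proj₂ (∧-true {verts J u} e))
                                 (reach-step o v (p⇒arc uv) (reach-refl o v)))

      two-roots : ∀ s t → verts J s ≡ true → root s ≡ true → verts J t ≡ true → root t ≡ true →
        s ≢ t → 2 ≤ size (verts J) → arcs p (verts J) ≤ k * (size (verts J) ∸ 2) + 1
      two-roots s t s∈ Ts t∈ Tt s≢t big = begin
        arcs p (verts J)                                        ≡⟨ arcs-split ⟩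
        arcs p (below s) + arcs p (below t) + arcs p rest
          ≤⟨ two-classes-bound {k} {arcs p (below s)} {arcs p (below t)} {arcs p rest}
                               {size (below s)} {size (below t)} {size rest} (subst (2 ≤_) size-split big)
               (below-bound s s∈ Ts) (below-bound t t∈ Tt) (arcs≤k*size p k p-deg rest) ⟩
        k * (size (below s) + size (below t) + size rest ∸ 2) + 1
          ≡⟨ cong (λ a → k * (a ∸ 2) + 1) size-split ⟨
        k * (size (verts J) ∸ 2) + 1 ∎
        where
        open ≤-Reasoning
        -- Vertices reachable from neither root are charged the plain bound of `k` arcs each.
        rest : Fin n → Bool
        rest x = verts J x ∧ not (reach o s x) ∧ not (reach o t x)
        partition : ∀ x → ⟦ verts J x ⟧ ≡ ⟦ below s x ⟧ + ⟦ below t x ⟧ + ⟦ rest x ⟧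
        partition x with verts J x | reach o s x in sx | reach o t x in tx
        ... | false | _ | _ = refl
        ... | true | true | true = contradiction (reaches-unique-root {x = x} Ts Tt sx tx) s≢t
        ... | true | true | false = refl
        ... | true | false | true = refl
        ... | true | false | false = refl
        sum₃ : (f g h : Fin n → ℕ) → sumF (λ x → f x + g x + h x) ≡ sumF f + sumF g + sumF h
        sum₃ f g h = trans (sumF-+ (λ x → f x + g x) h) (cong (_+ sumF h) (sumF-+ f g))
        size-split : size (verts J) ≡ size (below s) + size (below t) + size rest
        size-split = trans (sumF-cong partition)
          (sum₃ (λ x → ⟦ below s x ⟧) (λ x → ⟦ below t x ⟧) (λ x → ⟦ rest x ⟧))
        arcs-split : arcs p (verts J) ≡ arcs p (below s) + arcs p (below t) + arcs p rest
        arcs-split = trans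
          (sumF-cong λ x → trans (cong (_* outdeg p x) (partition x))
             (distrib₃ ⟦ below s x ⟧ ⟦ below t x ⟧ ⟦ rest x ⟧ (outdeg p x)))
          (sum₃ (λ x → ⟦ below s x ⟧ * outdeg p x) (λ x → ⟦ below t x ⟧ * outdeg p x)
                (λ x → ⟦ rest x ⟧ * outdeg p x))
          where
          distrib₃ : ∀ a b c d → (a + b + c) * d ≡ a * d + b * d + c * d
          distrib₃ = solve-∀

      arcs-bound : 2 ≤ size (verts J) → arcs p (verts J) ≤ k * (size (verts J) ∸ 2) + 1
      arcs-bound big
        with any? (λ s → any? (λ t → (verts J s ∧ root s ≟ᵇ true) ×-dec
                                     (verts J t ∧ root t ≟ᵇ true) ×-dec ¬? (s ≟ᶠ t)))
      ... | yes (s , t , es , et , s≢t) with ∧-true {verts J s} es | ∧-true {verts J t} et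
      ...   | s∈ , Ts | t∈ , Tt = two-roots s t s∈ Ts t∈ Tt s≢t big
      -- With at most one root, the whole vertex set of `J` serves as the closed set.
      arcs-bound big | no none =
        sparse-bound {k} {arcs p (verts J)} {size (verts J)} big (linear (verts J) one-root)
                     (arcs≤pairs p p-asym (verts J) (λ u v _ → p-head u v))
        where
        one-root : ∀ s t → verts J s ∧ root s ≡ true → verts J t ∧ root t ≡ true → s ≡ t
        one-root s t es et with s ≟ᶠ t
        ... | yes s≡t = s≡t
        ... | no  s≢t = ⊥-elim (none (s , t , es , et , s≢t))

    eJ-bound : 2 ≤ vJ J → eJ J ≤ k * (vJ J ∸ 2) + 1
    eJ-bound big = ≤-trans eJ≤arcs
      (subst (λ a → arcs p (verts J) ≤ k * (a ∸ 2) + 1) (≡-sym (count≡sumF (verts J)))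
             (arcs-bound (subst (2 ≤_) (count≡sumF (verts J)) big)))

theorem5p8 : (k : ℕ) {n : ℕ} (G : Graph n) → m≤ G k →
    Σ (Forest G) λ F → m₂≤ (G ∖ F) k
theorem5p8 k G sparse with hakimi k sparse
... | O , outdeg≤k =
  parentForest k O outdeg≤k ,
  -- On two vertices the edge count is at most `2 * k`, so one edge already gives the clause for
  -- `K₂`.
  (λ { 1≤e refl → ≤-trans 1≤e (eG≤ k O outdeg≤k) }) ,
  (λ _ _ J 3≤v → eJ-bound k O outdeg≤k J (≤-trans (n≤1+n 2) 3≤v))
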